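{- For $n\in\mathbb{N}$, the number of equivalence classes of the crossing-similarity relation $\sim_{cr}$ on $\mathcal{M}(n)$ equals $2^{n-2}\left(\binom{n}{2}+2\right)$.
   Context: A matching on $[2n]$ is a partition of $[2n]$ into $n$ two-element blocks (edges); $\mathcal{M}(n)$ is the set of such matchings. Edges $A,B$ cross if $\min A<\min B<\max A<\max B$ or vice versa; $cr(M)$ is the number of crossing pairs of edges. For $M\in\mathcal{M}(m)$, its children are the matchings obtained by choosing $x\in\{2,\dots,2m+2\}$, relabeling the vertices of $M$ order-preservingly by $\{2,\dots,2m+2\}\setminus\{x\}$ and adding the edge $\{1,x\}$. $\mathcal{T}(M,0)=\{M\}$ and $\mathcal{T}(M,l+1)$ is the set of children of members of $\mathcal{T}(M,l)$. $M\sim_{cr}N$ means that the multisets $cr(\mathcal{T}(M,l))=\{cr(P):P\in\mathcal{T}(M,l)\}$ and $cr(\mathcal{T}(N,l))$ are equal for every $l\ge 0$. -}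

module Defs where

open import Data.Nat using (ℕ; zero; suc; _+_; _<?_)
open import Data.Fin using (Fin; zero; suc; toℕ; punchIn; punchOut; _≟_)
open import Data.List using (List; []; _∷_; [_]; map; concatMap; filter; length; cartesianProduct; allFin)
open import Data.List.Relation.Binary.Permutation.Propositional using (_↭_)
open import Data.List.Relation.Unary.AllPairs using (AllPairs)
open import Data.List.Relation.Unary.Any using (Any)
open import Data.Product using (Σ; _×_; _,_; proj₁; proj₂)
open import Relation.Nullary using (¬_; yes; no)
open import Relation.Nullary.Decidable using (_×-dec_)
open import Relation.Binary.PropositionalEquality using (_≡_; _≢_)

dbl : ℕ → ℕ
dbl zero = zero
dbl (suc m) = suc (suc (dbl m))

-- Vertices of [2m] are encoded 0-indexed as Fin (dbl m) (vertex v ↦ v-1).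
-- A "raw" map sends each vertex to its partner.
Raw : ℕ → Set
Raw m = Fin (dbl m) → Fin (dbl m)

IsMatching : ∀ {m} → Raw m → Set
IsMatching {m} f = (∀ i → f (f i) ≡ i) × (∀ i → f i ≢ i)

Matching : ℕ → Set
Matching m = Σ (Raw m) IsMatching

-- cr(M): number of pairs (i , j) with i < j < f i < f j
-- (each crossing pair of edges {a,b},{c,d}, a<c<b<d, is counted exactly once).
cr : ∀ {m} → Raw m → ℕ
cr {m} f = length (filter (λ p → (toℕ (proj₁ p) <? toℕ (proj₂ p))
                              ×-dec ((toℕ (proj₂ p) <? toℕ (f (proj₁ p)))
                              ×-dec (toℕ (f (proj₁ p)) <? toℕ (f (proj₂ p)))))
                          (cartesianProduct (allFin (dbl m)) (allFin (dbl m))))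

-- The child of f for partner choice x : new vertex 0 (i.e. vertex 1) is matched with
-- suc x (i.e. vertex x+2 ∈ {2,…,2m+2}); old vertex j is relabelled to suc (punchIn x j),
-- the order-preserving bijection onto {2,…,2m+2} ∖ {x+2} (1-indexed).
child : ∀ {m} → Raw m → Fin (suc (dbl m)) → Raw (suc m)
child f x zero = suc x
child f x (suc k) with x ≟ k
... | yes _ = zero
... | no x≢k = suc (punchIn x (f (punchOut x≢k)))

children : ∀ {m} → Raw m → List (Raw (suc m))
children {m} f = map (child f) (allFin (suc (dbl m)))

-- T(M,l), as a list (it has no repetitions, so it represents the set faithfully)
T : ∀ {m} → Raw m → (l : ℕ) → List (Raw (l + m))
T f zero = [ f ]
T f (suc l) = concatMap children (T f l)

crT : ∀ {m} → Raw m → (l : ℕ) → List ℕ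
crT f l = map cr (T f l)

_∼cr_ : ∀ {m} → Raw m → Raw m → Set
f ∼cr g = ∀ l → crT f l ↭ crT g l

NumClasses : ℕ → ℕ → Set
NumClasses n k =
  Σ (List (Matching n)) λ reps →
    (length reps ≡ k)
    × AllPairs (λ M N → ¬ (proj₁ M ∼cr proj₁ N)) reps
    × (∀ (M : Matching n) → Any (λ R → proj₁ M ∼cr proj₁ R) reps)

{-# OPTIONS --safe #-}
-- View a matching of [2n] as a Dyck path, with the height of a gap being the number of edges over
-- it. Inserting the edge {1,x} at a gap of height h adds h crossings, and it turns the heights
-- a ++ h ∷ b into 0 ∷ (a ++ [ h ] raised by 1) ++ h ∷ b. In a descendant, the right ends that follow
-- the last new left end are spread in weakly increasing order over the gaps of the matching, so the
-- generating functions of the levels are combinations of complete homogeneous symmetric polynomials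
-- in the q^height. Hence M ~ N iff M and N have the same number of crossings and the same multiset of
-- heights (levels 0 and 1 give the converse). A multiset of heights amounts to a composition
-- (e_1, e_2, …) of n, with e_i the number of up steps to height i, and for a given composition the
-- number of crossings takes all values from 0 to Σ (i - 1) e_i. Summing 1 + Σ (i - 1) e_i over the
-- compositions gives the count.
module Submission where

open import Defs
open import Data.Bool using (Bool; true; false; if_then_else_)
open import Data.Fin using (Fin; zero; suc; toℕ; fromℕ<; punchIn; punchOut)
import Data.Fin as Fin
import Data.Fin.Properties as Finₚ
open import Data.List using (List; []; _∷_; [_]; _++_; map; concatMap; filter; length; cartesianProduct; tabulate; applyUpTo; upTo)
open import Data.List.Properties using (length-++; length-map; length-upTo; filter-++; map-++; map-∘; map-cong; map-tabulate; tabulate-cong; ++-assoc; ++-identityʳ; ∷-injectiveˡ; ∷-injectiveʳ)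
open import Data.List.Membership.Propositional using (_∈_; lose)
open import Data.List.Membership.Propositional.Properties using (∈-∃++; ∈-++⁺ˡ; ∈-++⁺ʳ; ∈-map⁺; ∈-upTo⁺)
open import Data.List.Relation.Binary.Permutation.Propositional as ↭ using (_↭_; ↭-refl; ↭-sym; ↭-trans; ↭-prep; ↭-swap; ↭-reflexive)
import Data.List.Relation.Binary.Permutation.Propositional.Properties as ↭ₚ
open import Data.List.Relation.Unary.All as All using (All; []; _∷_)
import Data.List.Relation.Unary.All.Properties as All
open import Data.List.Relation.Unary.AllPairs as AllPairs using (AllPairs; []; _∷_)
import Data.List.Relation.Unary.AllPairs.Properties as AllPairs
open import Data.List.Relation.Unary.Any using (Any; here; there)
import Data.List.Relation.Unary.Any.Properties as Any
open import Data.Nat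
open import Data.Nat.Combinatorics using (_C_; nC1≡n; nCk+nC[k+1]≡[n+1]C[k+1])
open import Data.Nat.ListAction using (sum)
open import Data.Nat.ListAction.Properties using (sum-++; sum-↭)
open import Data.Nat.Properties
open import Data.Nat.Tactic.RingSolver using (solve-∀)
open import Data.Product using (Σ; _×_; _,_; proj₁; proj₂; ∃; ∃₂)
open import Data.Sum as Sum using (_⊎_; inj₁; inj₂)
open import Data.Vec using (Vec; []; _∷_)
open import Function using (_∘_; id)
open import Level using (Level)
open import Relation.Binary.PropositionalEquality hiding ([_])
open import Relation.Nullary using (¬_; Dec; yes; no; does; contradiction)
open import Relation.Nullary.Decidable using (_×-dec_)
open import Relation.Unary using (Pred; Decidable)
open import Algebra.Properties.CommutativeMonoid.Sum +-0-commutativeMonoid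
  using (∑-distrib-+)
  renaming (sum to ∑; sum-remove to ∑-remove; sum-cong-≗ to ∑-cong; sum-replicate-zero to ∑-replicate-zero)

private variable
  p q : Level
  P : Set p
  Q : Set q
  A B : Set
  n c g h k : ℕ
  b s : List ℕ

-- Crossings and heights as sums of indicators

⟦_⟧ : Dec P → ℕ
⟦ d ⟧ = if does d then 1 else 0

⟦⟧-cong : (P → Q) → (Q → P) → (d : Dec P) (e : Dec Q) → ⟦ d ⟧ ≡ ⟦ e ⟧
⟦⟧-cong f g (yes _) (yes _) = refl
⟦⟧-cong f g (yes p) (no ¬q) = contradiction (f p) ¬q
⟦⟧-cong f g (no ¬p) (yes q) = contradiction (g q) ¬p
⟦⟧-cong f g (no _)  (no _)  = refl

⟦⟧-yes : P → (d : Dec P) → ⟦ d ⟧ ≡ 1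
⟦⟧-yes p (yes _) = refl
⟦⟧-yes p (no ¬p) = contradiction p ¬p

⟦⟧-no : ¬ P → (d : Dec P) → ⟦ d ⟧ ≡ 0
⟦⟧-no ¬p (yes p) = contradiction p ¬p
⟦⟧-no ¬p (no _)  = refl

∑-zero : ∀ {n} {t : Fin n → ℕ} → (∀ i → t i ≡ 0) → ∑ t ≡ 0
∑-zero {n} t≗0 = trans (∑-cong t≗0) (∑-replicate-zero n)

-- The summand of the new left vertex, of its partner, and of the old vertices.
∑-child : ∀ {n} (x : Fin (suc n)) (t : Fin (suc (suc n)) → ℕ) →
          ∑ t ≡ t zero + (t (suc x) + ∑ (λ j → t (suc (punchIn x j))))
∑-child x t = cong (t zero +_) (∑-remove {i = x} (t ∘ suc))

length-filter-tabulate : ∀ {n} {P : Pred A p} (P? : Decidable P) (t : Fin n → A) →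
  length (filter P? (tabulate t)) ≡ ∑ (λ i → ⟦ P? (t i) ⟧)
length-filter-tabulate {n = zero}  P? t = refl
length-filter-tabulate {n = suc n} P? t with does (P? (t zero))
... | true  = cong suc (length-filter-tabulate P? (t ∘ suc))
... | false = length-filter-tabulate P? (t ∘ suc)

length-filter-product : ∀ {m n} {P : Pred (A × B) p} (P? : Decidable P) (s : Fin m → A) (t : Fin n → B) →
  length (filter P? (cartesianProduct (tabulate s) (tabulate t))) ≡ ∑ (λ i → ∑ (λ j → ⟦ P? (s i , t j) ⟧))
length-filter-product {m = zero}  P? s t = refl
length-filter-product {m = suc m} P? s t = begin
  length (filter P? (map (s zero ,_) (tabulate t) ++ rest))
    ≡⟨ cong length (filter-++ P? (map (s zero ,_) (tabulate t)) rest) ⟩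
  length (filter P? (map (s zero ,_) (tabulate t)) ++ filter P? rest)
    ≡⟨ length-++ (filter P? (map (s zero ,_) (tabulate t))) ⟩
  length (filter P? (map (s zero ,_) (tabulate t))) + length (filter P? rest)
    ≡⟨ cong₂ _+_
         (trans (cong (length ∘ filter P?) (map-tabulate t (s zero ,_)))
                (length-filter-tabulate P? ((s zero ,_) ∘ t)))
         (length-filter-product P? (s ∘ suc) t) ⟩
  ∑ (λ j → ⟦ P? (s zero , t j) ⟧) + ∑ (λ i → ∑ (λ j → ⟦ P? (s (suc i) , t j) ⟧)) ∎
  where
  open ≡-Reasoning
  rest = cartesianProduct (tabulate (s ∘ suc)) (tabulate t)

Crosses : ∀ {n} → (Fin n → Fin n) → Fin n → Fin n → Set
Crosses f i j = toℕ i < toℕ j × toℕ j < toℕ (f i) × toℕ (f i) < toℕ (f j)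

crosses? : ∀ {n} (f : Fin n → Fin n) i j → Dec (Crosses f i j)
crosses? f i j = (toℕ i <? toℕ j) ×-dec ((toℕ j <? toℕ (f i)) ×-dec (toℕ (f i) <? toℕ (f j)))

cr-∑ : ∀ {m} (f : Raw m) → cr {m} f ≡ ∑ (λ i → ∑ (λ j → ⟦ crosses? f i j ⟧))
cr-∑ f = length-filter-product (λ (i , j) → crosses? f i j) id id

Covers : ∀ {n} → (Fin n → Fin n) → ℕ → Fin n → Set
Covers f g i = toℕ i < g × g ≤ toℕ (f i)

covers? : ∀ {n} (f : Fin n → Fin n) g i → Dec (Covers f g i)
covers? f g i = (toℕ i <? g) ×-dec (g ≤? toℕ (f i))

-- Gap g lies between the 0-indexed vertices g - 1 and g.
height : ∀ {n} → (Fin n → Fin n) → ℕ → ℕ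
height f g = ∑ (λ i → ⟦ covers? f g i ⟧)

heights : ∀ {m} → Raw m → List ℕ
heights {m} f = applyUpTo (height f) (suc (dbl m))

module _ {m} {f g : Raw m} (f≗g : f ≗ g) where

  cr-cong : cr {m} f ≡ cr {m} g
  cr-cong = trans (cr-∑ {m} f) (trans
    (∑-cong λ i → ∑-cong λ j → ⟦⟧-cong (to i j) (from i j) (crosses? f i j) (crosses? g i j))
    (sym (cr-∑ {m} g)))
    where
    to : ∀ i j → Crosses f i j → Crosses g i j
    to i j c rewrite f≗g i | f≗g j = c
    from : ∀ i j → Crosses g i j → Crosses f i j
    from i j c rewrite f≗g i | f≗g j = c

  height-cong : ∀ k → height f k ≡ height g k
  height-cong k = ∑-cong λ i → ⟦⟧-cong (to i) (from i) (covers? f k i) (covers? g k i)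
    where
    to : ∀ i → Covers f k i → Covers g k i
    to i c rewrite f≗g i = c
    from : ∀ i → Covers g k i → Covers f k i
    from i c rewrite f≗g i = c

applyUpTo-cong : {s t : ℕ → A} → s ≗ t → applyUpTo s ≗ applyUpTo t
applyUpTo-cong s≗t zero    = refl
applyUpTo-cong s≗t (suc n) = cong₂ _∷_ (s≗t 0) (applyUpTo-cong (s≗t ∘ suc) n)

-- Inserting a leftmost edge

punchIn-< : ∀ {n} (x : Fin (suc n)) (j : Fin n) → toℕ j < toℕ x → toℕ (punchIn x j) ≡ toℕ j
punchIn-< (suc x) zero    _         = refl
punchIn-< (suc x) (suc j) (s≤s j<x) = cong suc (punchIn-< x j j<x)

punchIn-≥ : ∀ {n} (x : Fin (suc n)) (j : Fin n) → toℕ x ≤ toℕ j → toℕ (punchIn x j) ≡ suc (toℕ j)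
punchIn-≥ zero    j       _         = refl
punchIn-≥ (suc x) (suc j) (s≤s x≤j) = cong suc (punchIn-≥ x j x≤j)

module _ {n} (x : Fin (suc n)) where

  punchIn-mono-< : ∀ i j → toℕ i < toℕ j → toℕ (punchIn x i) < toℕ (punchIn x j)
  punchIn-mono-< i j i<j = ≰⇒> λ q → <⇒≱ i<j (Finₚ.punchIn-cancel-≤ x j i q)

  punchIn-cancel-< : ∀ i j → toℕ (punchIn x i) < toℕ (punchIn x j) → toℕ i < toℕ j
  punchIn-cancel-< i j i<j = ≰⇒> λ q → <⇒≱ i<j (Finₚ.punchIn-mono-≤ x j i q)

  -- The new right end splits gap `x` into the gaps `x` and `suc x`. This module treats gaps up to
  -- the left half, which keep their index; the next one treats gaps from the right half on, which
  -- shift by one.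
  module _ {g} (g≤x : g ≤ toℕ x) (j : Fin n) where

    punchIn-<ˡ⁺ : toℕ j < g → toℕ (punchIn x j) < g
    punchIn-<ˡ⁺ j<g = subst (_< g) (sym (punchIn-< x j (<-≤-trans j<g g≤x))) j<g

    punchIn-<ˡ⁻ : toℕ (punchIn x j) < g → toℕ j < g
    punchIn-<ˡ⁻ q with toℕ j <? toℕ x
    ... | yes j<x = subst (_< g) (punchIn-< x j j<x) q
    ... | no  j≮x = <-trans (n<1+n _) (subst (_< g) (punchIn-≥ x j (≮⇒≥ j≮x)) q)

    punchIn-≥ˡ⁺ : g ≤ toℕ j → g ≤ toℕ (punchIn x j)
    punchIn-≥ˡ⁺ g≤j = ≮⇒≥ λ q → ≤⇒≯ g≤j (punchIn-<ˡ⁻ q)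

    punchIn-≥ˡ⁻ : g ≤ toℕ (punchIn x j) → g ≤ toℕ j
    punchIn-≥ˡ⁻ q = ≮⇒≥ λ j<g → ≤⇒≯ q (punchIn-<ˡ⁺ j<g)

  module _ {g} (x≤g : toℕ x ≤ g) (j : Fin n) where

    punchIn-<ʳ⁺ : toℕ j < g → toℕ (punchIn x j) < suc g
    punchIn-<ʳ⁺ j<g with toℕ j <? toℕ x
    ... | yes j<x = subst (_< suc g) (sym (punchIn-< x j j<x)) (m<n⇒m<1+n j<g)
    ... | no  j≮x = subst (_< suc g) (sym (punchIn-≥ x j (≮⇒≥ j≮x))) (s≤s j<g)

    punchIn-<ʳ⁻ : toℕ (punchIn x j) < suc g → toℕ j < g
    punchIn-<ʳ⁻ q with toℕ j <? toℕ x
    ... | yes j<x = <-≤-trans j<x x≤g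
    ... | no  j≮x = s≤s⁻¹ (subst (_< suc g) (punchIn-≥ x j (≮⇒≥ j≮x)) q)

    punchIn-≥ʳ⁺ : g ≤ toℕ j → suc g ≤ toℕ (punchIn x j)
    punchIn-≥ʳ⁺ g≤j = ≮⇒≥ λ q → ≤⇒≯ g≤j (punchIn-<ʳ⁻ q)

    punchIn-≥ʳ⁻ : suc g ≤ toℕ (punchIn x j) → g ≤ toℕ j
    punchIn-≥ʳ⁻ q = ≮⇒≥ λ j<g → ≤⇒≯ q (punchIn-<ʳ⁺ j<g)

module _ {m} (f : Raw m) (x : Fin (suc (dbl m))) where

  private f′ = child {m} f x

  child-new : f′ (suc x) ≡ zero
  child-new with x Fin.≟ x
  ... | yes _  = refl
  ... | no x≢x = contradiction refl x≢x

  child-old : ∀ j → f′ (suc (punchIn x j)) ≡ suc (punchIn x (f j))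
  child-old j with x Fin.≟ punchIn x j
  ... | yes x≡ = contradiction (sym x≡) (Finₚ.punchInᵢ≢i x j)
  ... | no x≢  = cong (suc ∘ punchIn x ∘ f)
    (trans (Finₚ.punchOut-cong x refl) (Finₚ.punchOut-punchIn x))

  -- The new edge starts at the leftmost vertex, so it crosses exactly the old edges that cover gap
  -- `x`; these make up the row of `zero`. The other rows and columns of the new edge vanish, and
  -- relabelling preserves the old crossings.
  cr-child : cr {suc m} f′ ≡ cr {m} f + height f (toℕ x)
  cr-child = begin
    cr {suc m} f′                                              ≡⟨ cr-∑ {suc m} f′ ⟩
    ∑ (λ i → ∑ (λ j → C i j))                                 ≡⟨ ∑-child x (λ i → ∑ (λ j → C i j)) ⟩
    ∑ (C zero) + (∑ (C (suc x)) + ∑ (λ i → ∑ (C (old i))))    ≡⟨ cong₂ _+_ row-zero (cong₂ _+_ row-new (∑-cong row-old)) ⟩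
    height f (toℕ x) + (0 + ∑ (λ i → ∑ (λ j → ⟦ crosses? f i j ⟧)))
                                                              ≡⟨ cong (height f (toℕ x) +_) (sym (cr-∑ {m} f)) ⟩
    height f (toℕ x) + cr {m} f                               ≡⟨ +-comm (height f (toℕ x)) (cr {m} f) ⟩
    cr {m} f + height f (toℕ x)                               ∎
    where
    open ≡-Reasoning
    C : Fin (dbl (suc m)) → Fin (dbl (suc m)) → ℕ
    C i j = ⟦ crosses? f′ i j ⟧
    old : Fin (dbl m) → Fin (dbl (suc m))
    old i = suc (punchIn x i)

    column-new : ∀ i → C i (suc x) ≡ 0
    column-new i = ⟦⟧-no
      (λ (_ , _ , q) → n≮0 (subst (λ v → toℕ (f′ i) < toℕ v) child-new q)) (crosses? f′ i (suc x))

    row-zero : ∑ (C zero) ≡ height f (toℕ x)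
    row-zero = trans (∑-child x (C zero)) (cong₂ _+_ (column-new zero) (∑-cong λ j →
      ⟦⟧-cong (to j) (from j) (crosses? f′ zero (old j)) (covers? f (toℕ x) j)))
      where
      to : ∀ j → Crosses f′ zero (old j) → Covers f (toℕ x) j
      to j (_ , q , r) rewrite child-old j =
        punchIn-<ˡ⁻ x ≤-refl j (s≤s⁻¹ q) , punchIn-≥ʳ⁻ x ≤-refl (f j) (s≤s⁻¹ r)
      from : ∀ j → Covers f (toℕ x) j → Crosses f′ zero (old j)
      from j (q , r) rewrite child-old j =
        z<s , s≤s (punchIn-<ˡ⁺ x ≤-refl j q) , s≤s (punchIn-≥ʳ⁺ x ≤-refl (f j) r)

    row-new : ∑ (C (suc x)) ≡ 0
    row-new = ∑-zero λ j → ⟦⟧-no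
      (λ (_ , q , _) → n≮0 (subst (λ v → toℕ j < toℕ v) child-new q)) (crosses? f′ (suc x) j)

    row-old : ∀ i → ∑ (C (old i)) ≡ ∑ (λ j → ⟦ crosses? f i j ⟧)
    row-old i = trans (∑-child x (C (old i))) (cong₂ _+_ (⟦⟧-no (λ { (() , _) }) (crosses? f′ (old i) zero))
      (cong₂ _+_ (column-new (old i)) (∑-cong λ j →
        ⟦⟧-cong (to j) (from j) (crosses? f′ (old i) (old j)) (crosses? f i j))))
      where
      to : ∀ j → Crosses f′ (old i) (old j) → Crosses f i j
      to j (q , r , s) rewrite child-old i | child-old j =
        punchIn-cancel-< x i j (s≤s⁻¹ q) , punchIn-cancel-< x j (f i) (s≤s⁻¹ r) ,
        punchIn-cancel-< x (f i) (f j) (s≤s⁻¹ s)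
      from : ∀ j → Crosses f i j → Crosses f′ (old i) (old j)
      from j (q , r , s) rewrite child-old i | child-old j =
        s≤s (punchIn-mono-< x i j q) , s≤s (punchIn-mono-< x j (f i) r) ,
        s≤s (punchIn-mono-< x (f i) (f j) s)

  height-child-0 : height f′ 0 ≡ 0
  height-child-0 = ∑-zero λ i → ⟦⟧-no (λ { (() , _) }) (covers? f′ 0 i)

  private
    new-doesn't-cover : ∀ g → ⟦ covers? f′ (suc g) (suc x) ⟧ ≡ 0
    new-doesn't-cover g = ⟦⟧-no
      (λ (_ , q) → n≮0 (subst (λ v → suc g ≤ toℕ v) child-new q)) (covers? f′ (suc g) (suc x))

  -- Here the new edge also lies over the gap, and only its left end precedes it; in
  -- `height-child-≥` both its ends do. At `g = toℕ x` the two lemmas give the two halves of the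
  -- split gap.
  height-child-≤ : ∀ g → g ≤ toℕ x → height f′ (suc g) ≡ suc (height f g)
  height-child-≤ g g≤x = trans (∑-child x (λ i → ⟦ covers? f′ (suc g) i ⟧)) (cong₂ _+_
    (⟦⟧-yes (z<s , s≤s g≤x) (covers? f′ (suc g) zero))
    (cong₂ _+_ (new-doesn't-cover g) (∑-cong λ j →
      ⟦⟧-cong (to j) (from j) (covers? f′ (suc g) (suc (punchIn x j))) (covers? f g j))))
    where
    to : ∀ j → Covers f′ (suc g) (suc (punchIn x j)) → Covers f g j
    to j (q , r) rewrite child-old j = punchIn-<ˡ⁻ x g≤x j (s≤s⁻¹ q) , punchIn-≥ˡ⁻ x g≤x (f j) (s≤s⁻¹ r)
    from : ∀ j → Covers f g j → Covers f′ (suc g) (suc (punchIn x j))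
    from j (q , r) rewrite child-old j = s≤s (punchIn-<ˡ⁺ x g≤x j q) , s≤s (punchIn-≥ˡ⁺ x g≤x (f j) r)

  height-child-≥ : ∀ g → toℕ x ≤ g → height f′ (suc (suc g)) ≡ height f g
  height-child-≥ g x≤g = trans (∑-child x (λ i → ⟦ covers? f′ (suc (suc g)) i ⟧)) (cong₂ _+_
    (⟦⟧-no (λ (_ , q) → ≤⇒≯ x≤g (s≤s⁻¹ q)) (covers? f′ (suc (suc g)) zero))
    (cong₂ _+_ (new-doesn't-cover (suc g)) (∑-cong λ j →
      ⟦⟧-cong (to j) (from j) (covers? f′ (suc (suc g)) (suc (punchIn x j))) (covers? f g j))))
    where
    to : ∀ j → Covers f′ (suc (suc g)) (suc (punchIn x j)) → Covers f g j
    to j (q , r) rewrite child-old j = punchIn-<ʳ⁻ x x≤g j (s≤s⁻¹ q) , punchIn-≥ʳ⁻ x x≤g (f j) (s≤s⁻¹ r)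
    from : ∀ j → Covers f g j → Covers f′ (suc (suc g)) (suc (punchIn x j))
    from j (q , r) rewrite child-old j = s≤s (punchIn-<ʳ⁺ x x≤g j q) , s≤s (punchIn-≥ʳ⁺ x x≤g (f j) r)

-- Sums over multisets

sum-δ⇒∈ : ∀ x ys → sum (map (λ y → ⟦ x ≟ y ⟧) ys) ≢ 0 → x ∈ ys
sum-δ⇒∈ x []       s≢0 = contradiction refl s≢0
sum-δ⇒∈ x (y ∷ ys) s≢0 with x ≟ y
... | yes x≡y = here x≡y
... | no  x≢y = there (sum-δ⇒∈ x ys λ s≡0 → s≢0 (cong₂ _+_ (⟦⟧-no x≢y (x ≟ y)) s≡0))

∈⇒↭-∷ : ∀ {x : A} {ys} → x ∈ ys → ∃ λ zs → ys ↭ x ∷ zs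
∈⇒↭-∷ {x = x} x∈ys with as , bs , refl ← ∈-∃++ x∈ys = as ++ bs , ↭ₚ.shift x as bs

sums⇒∈ : ∀ {x xs ys} → (∀ φ → sum (map φ (x ∷ xs)) ≡ sum (map φ ys)) → x ∈ ys
sums⇒∈ {x} {xs} {ys} eq = sum-δ⇒∈ x ys λ s≡0 → 1+n≢0 (begin
  suc (sum (map δ xs))      ≡⟨ cong (_+ sum (map δ xs)) (⟦⟧-yes refl (x ≟ x)) ⟨
  δ x + sum (map δ xs)      ≡⟨ eq δ ⟩
  sum (map δ ys)            ≡⟨ s≡0 ⟩
  0                         ∎)
  where
  open ≡-Reasoning
  δ : ℕ → ℕ
  δ y = ⟦ x ≟ y ⟧

-- Testing with the indicator of `x` finds `x` in `ys`; once it is cancelled on both sides, the sums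
-- still agree for every test function. The constant 1 rules out a surplus in `ys`.
sums⇒↭ : ∀ xs ys → (∀ φ → sum (map φ xs) ≡ sum (map φ ys)) → xs ↭ ys
sums⇒↭ []       []       eq = ↭-refl
sums⇒↭ []       (y ∷ ys) eq = contradiction (eq (λ _ → 1)) λ ()
sums⇒↭ (x ∷ xs) ys       eq with zs , ys↭ ← ∈⇒↭-∷ (sums⇒∈ {xs = xs} eq) =
  ↭-trans (↭-prep x (sums⇒↭ xs zs λ φ → +-cancelˡ-≡ (φ x) _ _
    (trans (eq φ) (sum-↭ (↭ₚ.map⁺ φ ys↭))))) (↭-sym ys↭)

sum-map-concatMap : ∀ (φ : B → ℕ) (f : A → List B) xs →
  sum (map φ (concatMap f xs)) ≡ sum (map (λ x → sum (map φ (f x))) xs)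
sum-map-concatMap φ f []       = refl
sum-map-concatMap φ f (x ∷ xs) = begin
  sum (map φ (f x ++ concatMap f xs))                      ≡⟨ cong sum (map-++ φ (f x) (concatMap f xs)) ⟩
  sum (map φ (f x) ++ map φ (concatMap f xs))              ≡⟨ sum-++ (map φ (f x)) (map φ (concatMap f xs)) ⟩
  sum (map φ (f x)) + sum (map φ (concatMap f xs))         ≡⟨ cong (sum (map φ (f x)) +_) (sum-map-concatMap φ f xs) ⟩
  sum (map φ (f x)) + sum (map (λ x → sum (map φ (f x))) xs) ∎
  where open ≡-Reasoning

-- Inserting at h turns the heights a ++ h ∷ b into map suc a ++ suc h ∷ h ∷ b (and a leading 0).
inserts : (ℕ → List ℕ → ℕ) → List ℕ → ℕ
inserts Ψ []      = 0
inserts Ψ (h ∷ s) = Ψ h (suc h ∷ h ∷ s) + inserts (λ k t → Ψ k (suc h ∷ t)) s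

inserts-cong : ∀ {Ψ Ψ′} → (∀ h t → Ψ h t ≡ Ψ′ h t) → ∀ s → inserts Ψ s ≡ inserts Ψ′ s
inserts-cong Ψ≗ []      = refl
inserts-cong Ψ≗ (h ∷ s) = cong₂ _+_ (Ψ≗ _ _) (inserts-cong (λ _ _ → Ψ≗ _ _) s)

interchange : ∀ a b c d → (a + b) + (c + d) ≡ (a + c) + (b + d)
interchange = solve-∀

inserts-+ : ∀ Ψ Ψ′ s → inserts (λ h t → Ψ h t + Ψ′ h t) s ≡ inserts Ψ s + inserts Ψ′ s
inserts-+ Ψ Ψ′ []      = refl
inserts-+ Ψ Ψ′ (h ∷ s) = trans
  (cong (Ψ h (suc h ∷ h ∷ s) + Ψ′ h (suc h ∷ h ∷ s) +_) (inserts-+ _ _ s))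
  (interchange (Ψ h (suc h ∷ h ∷ s)) _ _ _)

-- Insertion at gap 0 is the head term of `inserts`. Every later insertion raises the first height,
-- which can therefore be absorbed into `Ψ`.
inserts-applyUpTo : ∀ Ψ (s : ℕ → ℕ) n (t : Fin n → ℕ → ℕ) →
  (∀ x g → g ≤ toℕ x → t x g ≡ suc (s g)) →
  (∀ x g → toℕ x ≤ g → t x (suc g) ≡ s g) →
  sum (tabulate λ x → Ψ (s (toℕ x)) (applyUpTo (t x) (suc n))) ≡ inserts Ψ (applyUpTo s n)
inserts-applyUpTo Ψ s zero    t t-≤ t-≥ = refl
inserts-applyUpTo Ψ s (suc n) t t-≤ t-≥ = cong₂ _+_
  (cong (Ψ (s 0)) (cong₂ _∷_ (t-≤ zero 0 z≤n) (cong₂ _∷_ (t-≥ zero 0 z≤n)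
    (applyUpTo-cong (λ g → t-≥ zero (suc g) z≤n) n))))
  (trans
    (cong sum (tabulate-cong λ x →
      cong (λ h → Ψ (s (suc (toℕ x))) (h ∷ applyUpTo (t (suc x) ∘ suc) (suc n))) (t-≤ (suc x) 0 z≤n)))
    (inserts-applyUpTo (λ k u → Ψ k (suc (s 0) ∷ u)) (s ∘ suc) n (λ x → t (suc x) ∘ suc)
      (λ x g g≤x → t-≤ (suc x) (suc g) (s≤s g≤x)) (λ x g x≤g → t-≥ (suc x) (suc g) (s≤s x≤g))))

-- Summing functionals over descendants

Functional : Set
Functional = ℕ → List ℕ → ℕ

-- The dual of taking children: its value at a matching is the sum of `Φ` over the children, whose
-- leftmost gap has height 0.
extend : Functional → Functional
extend Φ c s = inserts (λ h t → Φ (c + h) (0 ∷ t)) s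

evaluate : Functional → ∀ {m} → Raw m → ℕ
evaluate Φ {m} f = Φ (cr {m} f) (heights {m} f)

sum-children : ∀ Φ {m} (f : Raw m) →
  sum (map (λ g → evaluate Φ {suc m} g) (children {m} f)) ≡ evaluate (extend Φ) {m} f
sum-children Φ {m} f = begin
  sum (map ev (map (child {m} f) (tabulate id)))             ≡⟨ cong sum (sym (map-∘ {g = ev} {f = child {m} f} (tabulate id))) ⟩
  sum (map (ev ∘ child {m} f) (tabulate id))                 ≡⟨ cong sum (map-tabulate id (ev ∘ child {m} f)) ⟩
  sum (tabulate (ev ∘ child {m} f))                          ≡⟨ cong sum (tabulate-cong λ x →
                                                                  cong₂ Φ (cr-child {m} f x) (cong (_∷ applyUpTo (height (child {m} f x) ∘ suc) (suc (suc (dbl m)))) (height-child-0 {m} f x))) ⟩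
  sum (tabulate λ x → Φ (cr {m} f + height f (toℕ x)) (0 ∷ applyUpTo (height (child {m} f x) ∘ suc) (suc (suc (dbl m)))))
                                                             ≡⟨ inserts-applyUpTo (λ h t → Φ (cr {m} f + h) (0 ∷ t)) (height f) (suc (dbl m))
                                                                  (λ x → height (child {m} f x) ∘ suc)
                                                                  (height-child-≤ {m} f) (height-child-≥ {m} f) ⟩
  evaluate (extend Φ) {m} f                                  ∎
  where
  open ≡-Reasoning
  ev : Raw (suc m) → ℕ
  ev g = evaluate Φ {suc m} g

-- The innermost `extend` accounts for the last generation, in accordance with the recursion of `T`.
extend^ : ℕ → Functional → Functional
extend^ zero    Φ = Φ
extend^ (suc l) Φ = extend^ l (extend Φ)

sum-T : ∀ l Φ {m} (f : Raw m) →
  sum (map (λ g → evaluate Φ {l + m} g) (T {m} f l)) ≡ evaluate (extend^ l Φ) {m} f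
sum-T zero    Φ {m} f = +-identityʳ _
sum-T (suc l) Φ {m} f = begin
  sum (map (λ g → evaluate Φ {suc l + m} g) (concatMap (children {l + m}) (T {m} f l)))
    ≡⟨ sum-map-concatMap (λ g → evaluate Φ {suc l + m} g) (children {l + m}) (T {m} f l) ⟩
  sum (map (λ g → sum (map (λ h → evaluate Φ {suc l + m} h) (children {l + m} g))) (T {m} f l))
    ≡⟨ cong sum (map-cong (sum-children Φ {l + m}) (T {m} f l)) ⟩
  sum (map (λ g → evaluate (extend Φ) {l + m} g) (T {m} f l))
    ≡⟨ sum-T l (extend Φ) {m} f ⟩
  evaluate (extend^ (suc l) Φ) {m} f ∎
  where open ≡-Reasoning

-- Complete homogeneous symmetric functions

-- hom k s φ is the sum of φ (aᵢ₁ + … + aᵢₖ) over i₁ ≤ … ≤ iₖ, that is, the complete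
-- homogeneous symmetric polynomial hₖ(qᵃ¹, qᵃ², …) with qᵛ read as φ v.
hom : ℕ → List ℕ → (ℕ → ℕ) → ℕ
hom zero    s       φ = φ 0
hom (suc k) []      φ = 0
hom (suc k) (a ∷ s) φ = hom k (a ∷ s) (λ v → φ (a + v)) + hom (suc k) s φ

hom-cong : ∀ k s {φ ψ} → φ ≗ ψ → hom k s φ ≡ hom k s ψ
hom-cong zero    s       φ≗ψ = φ≗ψ 0
hom-cong (suc k) []      φ≗ψ = refl
hom-cong (suc k) (a ∷ s) φ≗ψ = cong₂ _+_ (hom-cong k (a ∷ s) (λ v → φ≗ψ (a + v))) (hom-cong (suc k) s φ≗ψ)

hom-∷ : ∀ a {s t} → (∀ k φ → hom k s φ ≡ hom k t φ) → ∀ k φ → hom k (a ∷ s) φ ≡ hom k (a ∷ t) φ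
hom-∷ a s≈t zero    φ = refl
hom-∷ a s≈t (suc k) φ = cong₂ _+_ (hom-∷ a s≈t k _) (s≈t (suc k) φ)

shift-comm : ∀ a b v → a + (b + v) ≡ b + (a + v)
shift-comm = solve-∀

-- With x, y for the two letters, h_{k+2}(x,y,s) = xy h_k(x,y,s) + x h_{k+1}(x,s) + y h_{k+1}(y,s) +
-- h_{k+2}(s), which is symmetric in x and y.
hom-swap : ∀ a b s k φ → hom k (a ∷ b ∷ s) φ ≡ hom k (b ∷ a ∷ s) φ
hom-swap a b s zero          φ = refl
hom-swap a b s (suc zero)    φ = rearrange (φ (a + 0)) (φ (b + 0)) _
  where
  rearrange : ∀ x y z → x + (y + z) ≡ y + (x + z)
  rearrange = solve-∀
hom-swap a b s (suc (suc k)) φ = begin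
  hom (suc k) (a ∷ b ∷ s) φᵃ + (hom (suc k) (b ∷ s) φᵇ + z)
    ≡⟨ cong (_+ (hom (suc k) (b ∷ s) φᵇ + z)) (hom-swap a b s (suc k) φᵃ) ⟩
  (hom k (b ∷ a ∷ s) φᵃᵇ + hom (suc k) (a ∷ s) φᵃ) + (hom (suc k) (b ∷ s) φᵇ + z)
    ≡⟨ rearrange (hom k (b ∷ a ∷ s) φᵃᵇ) _ _ _ ⟩
  (hom k (b ∷ a ∷ s) φᵃᵇ + hom (suc k) (b ∷ s) φᵇ) + (hom (suc k) (a ∷ s) φᵃ + z)
    ≡⟨ cong (λ u → (u + hom (suc k) (b ∷ s) φᵇ) + (hom (suc k) (a ∷ s) φᵃ + z))
         (trans (hom-swap b a s k φᵃᵇ) (hom-cong k (a ∷ b ∷ s) λ v → cong φ (shift-comm a b v))) ⟩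
  hom (suc k) (a ∷ b ∷ s) φᵇ + (hom (suc k) (a ∷ s) φᵃ + z)
    ≡⟨ cong (_+ (hom (suc k) (a ∷ s) φᵃ + z)) (hom-swap a b s (suc k) φᵇ) ⟩
  hom (suc k) (b ∷ a ∷ s) φᵇ + (hom (suc k) (a ∷ s) φᵃ + z) ∎
  where
  open ≡-Reasoning
  φᵃ φᵇ φᵃᵇ : ℕ → ℕ
  φᵃ  v = φ (a + v)
  φᵇ  v = φ (b + v)
  φᵃᵇ v = φ (a + (b + v))
  z = hom (suc (suc k)) s φ
  rearrange : ∀ x y u v → (x + y) + (u + v) ≡ (x + u) + (y + v)
  rearrange = solve-∀

hom-↭ : ∀ {s t} → s ↭ t → ∀ k φ → hom k s φ ≡ hom k t φ
hom-↭ ↭.refl                   k φ = refl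
hom-↭ (↭.prep a p)             k φ = hom-∷ a (hom-↭ p) k φ
hom-↭ (↭.swap {xs = s} a b p)  k φ = trans (hom-swap a b s k φ) (hom-∷ b (hom-∷ a (hom-↭ p)) k φ)
hom-↭ (↭.trans p q)            k φ = trans (hom-↭ p k φ) (hom-↭ q k φ)

-- Σ_x y_x h_k(q y_0, …, q y_x, y_x, …, y_n) = (1 + q + … + q^k) h_{k+1}(y_0, …, y_n): both sides
-- sum over the monomials y_{i_0} ⋯ y_{i_k} with i_0 ≤ … ≤ i_k and one marked factor y_{i_j}, weighted
-- by q^j.
inserts-hom : ∀ k s (φ : ℕ → ℕ) →
  inserts (λ h t → hom k t (λ v → φ (h + v))) s ≡ ∑ {suc k} (λ j → hom (suc k) s (λ v → φ (toℕ j + v)))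
inserts-hom k [] φ = sym (∑-zero {suc k} λ _ → refl)
inserts-hom zero (a ∷ s) φ = begin
  φ (a + 0) + inserts (λ h t → φ (h + 0)) s ≡⟨ cong (φ (a + 0) +_) (inserts-hom zero s φ) ⟩
  φ (a + 0) + (hom 1 s φ + 0)               ≡⟨ sym (+-assoc (φ (a + 0)) _ 0) ⟩
  φ (a + 0) + hom 1 s φ + 0                 ∎
  where open ≡-Reasoning
inserts-hom (suc k) (a ∷ s) φ = begin
  (x + first) + inserts (λ h t → Ψ₁ h t + Ψ₂ h t) s
    ≡⟨ cong (x + first +_) (inserts-+ Ψ₁ Ψ₂ s) ⟩
  (x + first) + (inserts Ψ₁ s + inserts Ψ₂ s)
    -- The terms containing the raised letter `suc a` form the instance of degree `k` over `a ∷ s`,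
    -- and `Ψ₂` gives the instance over `s`. What remains, `first`, becomes the summand `j = 0` of
    -- `marked`.
    ≡⟨ rearrange x first (inserts Ψ₁ s) (inserts Ψ₂ s) ⟩
  (first + inserts (λ h t → hom k t (λ v → φ (h + (suc a + v)))) (a ∷ s)) + inserts Ψ₂ s
    ≡⟨ cong (λ u → (first + u) + inserts Ψ₂ s) (trans
         (inserts-cong (λ h t → hom-cong k t λ v → cong φ (shift-comm h (suc a) v)) (a ∷ s))
         (inserts-hom k (a ∷ s) (λ v → φ (suc a + v)))) ⟩
  (first + ∑ {suc k} (λ j → hom (suc k) (a ∷ s) (λ v → φ (suc a + (toℕ j + v))))) + inserts Ψ₂ s
    ≡⟨ cong₂ (λ u w → (first + u) + w)
         (∑-cong {suc k} λ j → hom-cong (suc k) (a ∷ s) λ v → cong (φ ∘ suc) (shift-comm a (toℕ j) v))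
         (inserts-hom (suc k) s φ) ⟩
  ∑ {suc (suc k)} marked + ∑ {suc (suc k)} unmarked
    ≡⟨ sym (∑-distrib-+ {suc (suc k)} marked unmarked) ⟩
  ∑ {suc (suc k)} (λ j → hom (suc (suc k)) (a ∷ s) (λ v → φ (toℕ j + v))) ∎
  where
  open ≡-Reasoning
  x     = hom k (suc a ∷ a ∷ s) (λ v → φ (a + (suc a + v)))
  first = hom (suc k) (a ∷ s) (λ v → φ (a + v))
  Ψ₁ Ψ₂ : ℕ → List ℕ → ℕ
  Ψ₁ h t = hom k (suc a ∷ t) (λ v → φ (h + (suc a + v)))
  Ψ₂ h t = hom (suc k) t (λ v → φ (h + v))
  marked unmarked : Fin (suc (suc k)) → ℕ
  marked j   = hom (suc k) (a ∷ s) (λ v → φ (toℕ j + (a + v)))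
  unmarked j = hom (suc (suc k)) s (λ v → φ (toℕ j + v))
  rearrange : ∀ x y u v → (x + y) + (u + v) ≡ (y + (x + u)) + v
  rearrange = solve-∀

-- Finite sums of complete homogeneous polynomials, with the crossing number acting as a shift of
-- `φ`. The constructors carry pointwise equations, so the class is closed under pointwise equality.
data Symmetric (Φ : Functional) : Set where
  homogeneous : ∀ k (φ : ℕ → ℕ) → (∀ c s → Φ c s ≡ hom k s (λ v → φ (c + v))) → Symmetric Φ
  sum-of      : ∀ {Φ₁ Φ₂} → Symmetric Φ₁ → Symmetric Φ₂ → (∀ c s → Φ c s ≡ Φ₁ c s + Φ₂ c s) → Symmetric Φ

symmetric-≗ : ∀ {Φ Φ′} → (∀ c s → Φ′ c s ≡ Φ c s) → Symmetric Φ → Symmetric Φ′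
symmetric-≗ Φ≗ (homogeneous k φ eq) = homogeneous k φ λ c s → trans (Φ≗ c s) (eq c s)
symmetric-≗ Φ≗ (sum-of S₁ S₂ eq)    = sum-of S₁ S₂ λ c s → trans (Φ≗ c s) (eq c s)

symmetric-∑ : ∀ {n} {Φ : Fin n → Functional} → (∀ i → Symmetric (Φ i)) → Symmetric (λ c s → ∑ (λ i → Φ i c s))
symmetric-∑ {zero}  S = homogeneous 0 (λ _ → 0) λ _ _ → refl
symmetric-∑ {suc n} S = sum-of (S zero) (symmetric-∑ (S ∘ suc)) λ _ _ → refl

symmetric-inserts-hom : ∀ k φ → Symmetric (λ c s → inserts (λ h t → hom k t (λ v → φ ((c + h) + v))) s)
symmetric-inserts-hom k φ = symmetric-≗
  (λ c s → trans (inserts-cong (λ h t → hom-cong k t λ v → cong φ (+-assoc c h v)) s)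
                 (inserts-hom k s (λ v → φ (c + v))))
  (symmetric-∑ {suc k} λ j → homogeneous (suc k) (λ v → φ (toℕ j + v)) λ c s →
    hom-cong (suc k) s λ v → cong φ (shift-comm c (toℕ j) v))

-- The leading height 0 is a letter equal to q^0 = 1, and h_k(1, t) is the sum of h_i(t) over i ≤ k;
-- `inserts-hom` applies to each summand.
symmetric-extend-hom : ∀ k (φ : ℕ → ℕ) → Symmetric (extend λ c s → hom k s (λ v → φ (c + v)))
symmetric-extend-hom zero    φ = symmetric-inserts-hom 0 φ
symmetric-extend-hom (suc k) φ =
  sum-of (symmetric-extend-hom k φ) (symmetric-inserts-hom (suc k) φ) λ c s → inserts-+
    (λ h t → hom k (0 ∷ t) (λ v → φ ((c + h) + v))) (λ h t → hom (suc k) t (λ v → φ ((c + h) + v))) s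

symmetric-extend : ∀ {Φ} → Symmetric Φ → Symmetric (extend Φ)
symmetric-extend (homogeneous k φ eq) = symmetric-≗
  (λ c s → inserts-cong (λ h t → eq (c + h) (0 ∷ t)) s) (symmetric-extend-hom k φ)
symmetric-extend (sum-of {Φ₁} {Φ₂} S₁ S₂ eq) = sum-of (symmetric-extend S₁) (symmetric-extend S₂)
  λ c s → trans (inserts-cong (λ h t → eq (c + h) (0 ∷ t)) s)
                (inserts-+ (λ h t → Φ₁ (c + h) (0 ∷ t)) (λ h t → Φ₂ (c + h) (0 ∷ t)) s)

symmetric-extend^ : ∀ l {Φ} → Symmetric Φ → Symmetric (extend^ l Φ)
symmetric-extend^ zero    S = S
symmetric-extend^ (suc l) S = symmetric-extend^ l (symmetric-extend S)

symmetric-↭ : ∀ {Φ} → Symmetric Φ → ∀ c {s t} → s ↭ t → Φ c s ≡ Φ c t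
symmetric-↭ (homogeneous k φ eq) c {s} {t} s↭t = trans (eq c s) (trans (hom-↭ s↭t k _) (sym (eq c t)))
symmetric-↭ (sum-of S₁ S₂ eq)    c {s} {t} s↭t =
  trans (eq c s) (trans (cong₂ _+_ (symmetric-↭ S₁ c s↭t) (symmetric-↭ S₂ c s↭t)) (sym (eq c t)))

-- Crossing similarity in terms of crossings and heights

_≈cr_ : ∀ {m} → Raw m → Raw m → Set
_≈cr_ {m} f g = cr {m} f ≡ cr {m} g × heights {m} f ↭ heights {m} g

-- A test function of the crossing number alone is homogeneous of degree 0, so its sum over level
-- `l` is a symmetric functional of the ancestor.
≈cr⇒∼cr : ∀ {m} {f g : Raw m} → _≈cr_ {m} f g → _∼cr_ {m} f g
≈cr⇒∼cr {m} {f} {g} (cr≡ , heights↭) l = sums⇒↭ (crT {m} f l) (crT {m} g l) λ φ → begin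
  sum (map φ (crT {m} f l))                          ≡⟨ count φ f ⟩
  evaluate (extend^ l (λ c _ → φ c)) {m} f           ≡⟨ symmetric-↭ (symmetric-extend^ l (symm φ)) _ heights↭ ⟩
  extend^ l (λ c _ → φ c) (cr {m} f) (heights {m} g) ≡⟨ cong (λ c → extend^ l (λ c _ → φ c) c (heights {m} g)) cr≡ ⟩
  evaluate (extend^ l (λ c _ → φ c)) {m} g           ≡⟨ sym (count φ g) ⟩
  sum (map φ (crT {m} g l))                          ∎
  where
  open ≡-Reasoning
  count : ∀ φ (f : Raw m) → sum (map φ (crT {m} f l)) ≡ evaluate (extend^ l (λ c _ → φ c)) {m} f
  count φ f = trans (cong sum (sym (map-∘ {g = φ} {f = cr {l + m}} (T {m} f l)))) (sum-T l (λ c _ → φ c) {m} f)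
  symm : ∀ φ → Symmetric (λ c _ → φ c)
  symm φ = homogeneous 0 φ λ c _ → cong φ (sym (+-identityʳ c))

tabulate-applyUpTo : ∀ (f : ℕ → A) n → tabulate {n = n} (f ∘ toℕ) ≡ applyUpTo f n
tabulate-applyUpTo f zero    = refl
tabulate-applyUpTo f (suc n) = cong (f 0 ∷_) (tabulate-applyUpTo (f ∘ suc) n)

crT-1 : ∀ {m} (f : Raw m) → crT {m} f 1 ≡ map (cr {m} f +_) (heights {m} f)
crT-1 {m} f = begin
  map (cr {suc m}) (concatMap (children {m}) [ f ])
    ≡⟨ cong (map (cr {suc m})) (++-identityʳ (children {m} f)) ⟩
  map (cr {suc m}) (map (child {m} f) (tabulate id))
    ≡⟨ sym (map-∘ (tabulate id)) ⟩
  map (cr {suc m} ∘ child {m} f) (tabulate id)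
    ≡⟨ map-cong (cr-child {m} f) (tabulate id) ⟩
  map (λ x → cr {m} f + height f (toℕ x)) (tabulate id)
    ≡⟨ map-tabulate id _ ⟩
  tabulate (λ x → cr {m} f + height f (toℕ x))
    ≡⟨ sym (map-tabulate (height f ∘ toℕ) (cr {m} f +_)) ⟩
  map (cr {m} f +_) (tabulate (height f ∘ toℕ))
    ≡⟨ cong (map (cr {m} f +_)) (tabulate-applyUpTo (height f) (suc (dbl m))) ⟩
  map (cr {m} f +_) (heights {m} f) ∎
  where
  open ≡-Reasoning

-- Level 1 is the multiset of heights shifted by the crossing number, which level 0 reveals;
-- subtracting it recovers the heights.
∼cr⇒≈cr : ∀ {m} {f g : Raw m} → _∼cr_ {m} f g → _≈cr_ {m} f g
∼cr⇒≈cr {m} {f} {g} f∼g = cr≡ , heights↭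
  where
  open ↭.PermutationReasoning
  cr≡ : cr {m} f ≡ cr {m} g
  cr≡ = ∷-injectiveˡ (↭ₚ.↭-singleton-inv (f∼g 0))
  cancel : ∀ c s → map (_∸ c) (map (c +_) s) ≡ s
  cancel c []      = refl
  cancel c (h ∷ s) = cong₂ _∷_ (m+n∸m≡n c h) (cancel c s)
  heights↭ : heights {m} f ↭ heights {m} g
  heights↭ = begin
    heights {m} f                                               ≡⟨ cancel (cr {m} f) (heights {m} f) ⟨
    map (_∸ cr {m} f) (map (cr {m} f +_) (heights {m} f))       ≡⟨ cong (map (_∸ cr {m} f)) (crT-1 {m} f) ⟨
    map (_∸ cr {m} f) (crT {m} f 1)                             ↭⟨ ↭ₚ.map⁺ (_∸ cr {m} f) (f∼g 1) ⟩
    map (_∸ cr {m} f) (crT {m} g 1)                             ≡⟨ cong₂ (λ c s → map (_∸ c) s) cr≡ (crT-1 {m} g) ⟩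
    map (_∸ cr {m} g) (map (cr {m} g +_) (heights {m} g))       ≡⟨ cancel (cr {m} g) (heights {m} g) ⟩
    heights {m} g                                               ∎

-- Lattice paths

-- Reach n c s: some matching of size n has c crossings and gap heights s.
data Reach : ℕ → ℕ → List ℕ → Set where
  start : Reach 0 0 [ 0 ]
  step  : ∀ a → Reach n c (a ++ h ∷ b) → Reach (suc n) (c + h) (0 ∷ map suc a ++ suc h ∷ h ∷ b)

-- Path n h s: s lists the heights of a nonnegative lattice path from h to 0 with n up steps.
data Path : ℕ → ℕ → List ℕ → Set where
  end  : Path 0 0 [ 0 ]
  up   : Path n (suc h) s → Path (suc n) h (h ∷ s)
  down : Path n h s → Path n (suc h) (suc h ∷ s)

path-head : Path n h s → ∃ λ t → s ≡ h ∷ t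
path-head end      = _ , refl
path-head (up p)   = _ , refl
path-head (down p) = _ , refl

-- The new right end becomes a down step at the chosen gap, and the path before it is lifted by one.
-- The up step of the new left end is added in `reach⇒path`.
raise : Path n g s → ∀ a → s ≡ a ++ h ∷ b → Path n (suc g) (map suc a ++ suc h ∷ h ∷ b)
raise end      []          refl = down end
raise end      (_ ∷ [])    ()
raise end      (_ ∷ _ ∷ _) ()
raise (up p)   []          refl = down (up p)
raise (up p)   (_ ∷ a)     refl = up (raise p a refl)
raise (down p) []          refl = down (down p)
raise (down p) (_ ∷ a)     refl = down (raise p a refl)

path-bound : Path n g s → ∀ a → s ≡ a ++ h ∷ b → h ≤ g + length a
path-bound end      []          refl = z≤n
path-bound end      (_ ∷ [])    ()
path-bound end      (_ ∷ _ ∷ _) ()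
path-bound (up p)   []          refl = m≤m+n _ 0
path-bound (up {h = g} p) (_ ∷ a) refl = ≤-trans (path-bound p a refl) (≤-reflexive (sym (+-suc g (length a))))
path-bound (down p) []          refl = m≤m+n _ 0
path-bound (down {h = g} p) (_ ∷ a) refl = ≤-trans (path-bound p a refl) (+-mono-≤ (n≤1+n g) (n≤1+n (length a)))

reach⇒path : Reach n c s → Path n 0 s
reach⇒path start      = end
reach⇒path (step a R) = up (raise (reach⇒path R) a refl)

-- The last component lets the rest of the path be exchanged for any other one with the same
-- starting height and number of up steps.
split-path : Path n g s → ∀ a → s ≡ a ++ h ∷ b →
  ∃ λ k → Path k h (h ∷ b) × (∀ {t} → Path k h t → Path n g (a ++ t))
split-path end      []          refl = 0 , end , id
split-path end      (_ ∷ [])    ()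
split-path end      (_ ∷ _ ∷ _) ()
split-path (up p)   []          refl = _ , up p , id
split-path (up p)   (_ ∷ a)     refl with k , q , plug ← split-path p a refl = k , q , up ∘ plug
split-path (down p) []          refl = _ , down p , id
split-path (down p) (_ ∷ a)     refl with k , q , plug ← split-path p a refl = k , q , down ∘ plug

-- Before its first step from `suc k` to `k` the path stays above `k`; deleting that step and
-- lowering what precedes it inverts `raise`.
first-passage : ∀ k j → Path n (suc (j + k)) s →
  ∃₂ λ a r → s ≡ map suc a ++ suc k ∷ k ∷ r × Path n (j + k) (a ++ k ∷ r)
first-passage k j (up p) with a , r , refl , q ← first-passage k (suc j) p = j + k ∷ a , r , refl , up q
first-passage k zero (down p) with r , refl ← path-head p = [] , r , refl , p
first-passage k (suc j) (down p) with a , r , refl , q ← first-passage k j p = suc (j + k) ∷ a , r , refl , down q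

-- Matching the first up step with the first return to 0 inserts the edge at height 0, so no
-- crossing arises.
path⇒reach-0 : Path n 0 s → Reach n 0 s
path⇒reach-0 end    = start
path⇒reach-0 (up p) with a , r , refl , q ← first-passage 0 0 p = step a (path⇒reach-0 q)

-- If all crossings involve the leftmost edge {1,x}, then exchanging its right end with that of the
-- innermost edge crossing it removes exactly one crossing and keeps the path, and the edges other
-- than the leftmost one remain noncrossing.
lower : Reach n k s → k ≡ suc c → Reach n c s
lower start ()
lower (step {c = suc c₀} a R) refl = step a (lower R refl)
lower (step {c = zero} {h = suc h} {b = b} a R) refl
  with k , p , plug ← split-path (reach⇒path R) a refl
  with B , r , eq , q ← first-passage h 0 p =
  -- `down q` moves the descent from `suc h` to `h` to the old insertion gap, and the new edge goes
  -- to the place of that descent, a gap of height `h`.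
  subst (Reach _ h) (cong (0 ∷_) path≡) (step (a ++ suc h ∷ B) (path⇒reach-0
    (subst (Path _ 0) (sym (++-assoc a (suc h ∷ B) (h ∷ r))) (plug (down q)))))
  where
  open ≡-Reasoning
  path≡ : map suc (a ++ suc h ∷ B) ++ suc h ∷ h ∷ r ≡ map suc a ++ suc (suc h) ∷ suc h ∷ b
  path≡ = begin
    map suc (a ++ suc h ∷ B) ++ suc h ∷ h ∷ r              ≡⟨ cong (_++ suc h ∷ h ∷ r) (map-++ suc a (suc h ∷ B)) ⟩
    (map suc a ++ map suc (suc h ∷ B)) ++ suc h ∷ h ∷ r    ≡⟨ ++-assoc (map suc a) (map suc (suc h ∷ B)) (suc h ∷ h ∷ r) ⟩
    map suc a ++ suc (suc h) ∷ map suc B ++ suc h ∷ h ∷ r  ≡⟨ cong (λ t → map suc a ++ suc (suc h) ∷ t) eq ⟨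
    map suc a ++ suc (suc h) ∷ suc h ∷ b                   ∎

lower^ : ∀ d → Reach n c s → Reach n (c ∸ d) s
lower^             zero    R = R
lower^ {c = zero}  (suc d) R = R
lower^ {c = suc c} (suc d) R = lower^ d (lower R refl)

sum-map-suc : ∀ s → sum (map suc s) ≡ sum s + length s
sum-map-suc []      = refl
sum-map-suc (h ∷ s) = trans (cong (suc h +_) (sum-map-suc s)) (rearrange h (sum s) (length s))
  where
  rearrange : ∀ x y z → suc x + (y + z) ≡ (x + y) + suc z
  rearrange = solve-∀

-- An insertion at height `h` after the prefix `a` adds `length a + suc h` to the sum of heights and
-- `1 + 2 * h` to the left side, while `h ≤ length a` by `path-bound`.
reach-bound : Reach n c s → n + 2 * c ≤ sum s
reach-bound start = z≤n
reach-bound (step {n} {c} {h} {b} a R) = begin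
  suc n + 2 * (c + h)                          ≡⟨ rearrange n c h ⟩
  ((n + 2 * c) + h) + suc h                    ≤⟨ +-monoˡ-≤ (suc h) (+-mono-≤ (reach-bound R) (path-bound (reach⇒path R) a refl)) ⟩
  (sum (a ++ h ∷ b) + length a) + suc h        ≡⟨ cong (λ x → (x + length a) + suc h) (sum-++ a (h ∷ b)) ⟩
  ((sum a + (h + sum b)) + length a) + suc h   ≡⟨ rearrange′ (sum a) (sum b) (length a) h ⟩
  (sum a + length a) + (suc h + (h + sum b))   ≡⟨ cong (_+ (suc h + (h + sum b))) (sum-map-suc a) ⟨
  sum (map suc a) + (suc h + (h + sum b))      ≡⟨ sum-++ (map suc a) (suc h ∷ h ∷ b) ⟨
  sum (map suc a ++ suc h ∷ h ∷ b)             ∎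
  where
  open ≤-Reasoning
  rearrange : ∀ n c h → suc n + 2 * (c + h) ≡ ((n + 2 * c) + h) + suc h
  rearrange = solve-∀
  rearrange′ : ∀ x y z h → ((x + (h + y)) + z) + suc h ≡ (x + z) + (suc h + (h + y))
  rearrange′ = solve-∀

-- Profiles of paths

-- An up step from level ℓ and the matching down step contribute the heights ℓ and ℓ + 1.
pairs : List ℕ → List ℕ
pairs []      = []
pairs (ℓ ∷ L) = ℓ ∷ suc ℓ ∷ pairs L

pairs-↭ : ∀ {L M} → L ↭ M → pairs L ↭ pairs M
pairs-↭ ↭.refl        = ↭-refl
pairs-↭ (↭.prep x p)  = ↭-prep x (↭-prep (suc x) (pairs-↭ p))
pairs-↭ (↭.swap {xs} x y p) = ↭-trans
  (↭ₚ.shifts (x ∷ suc x ∷ []) (y ∷ suc y ∷ []))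
  (↭ₚ.++⁺ˡ (y ∷ suc y ∷ x ∷ suc x ∷ []) (pairs-↭ p))
pairs-↭ (↭.trans p q) = ↭-trans (pairs-↭ p) (pairs-↭ q)

sum-pairs : ∀ L → sum (pairs L) ≡ length L + 2 * sum L
sum-pairs []      = refl
sum-pairs (ℓ ∷ L) = trans (cong (λ x → ℓ + (suc ℓ + x)) (sum-pairs L)) (rearrange ℓ (length L) (sum L))
  where
  rearrange : ∀ x y z → x + (suc x + (y + 2 * z)) ≡ suc y + 2 * (x + z)
  rearrange = solve-∀

-- A word of n bits encodes a composition of n + 1, via the levels of the up steps listed from the
-- top: the bits tell where a new level starts.
top : Vec Bool n → ℕ
top []          = 0
top (false ∷ w) = top w
top (true ∷ w)  = suc (top w)

levels : Vec Bool n → List ℕ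
levels []      = [ 0 ]
levels (b ∷ w) = top (b ∷ w) ∷ levels w

-- The largest crossing number for this composition: attained in `staircase`, an upper bound by
-- `reach⇒profile`.
weight : Vec Bool n → ℕ
weight w = sum (levels w)

-- The extra 0 is the height of the last gap, where the path ends.
profile : Vec Bool n → List ℕ
profile w = 0 ∷ pairs (levels w)

profile-∷ : ∀ b (w : Vec Bool n) → profile (b ∷ w) ↭ top (b ∷ w) ∷ suc (top (b ∷ w)) ∷ profile w
profile-∷ b w = ↭-sym (↭ₚ.shift 0 (top (b ∷ w) ∷ suc (top (b ∷ w)) ∷ []) (pairs (levels w)))

length-levels : ∀ (w : Vec Bool n) → length (levels w) ≡ suc n
length-levels []      = refl
length-levels (b ∷ w) = cong suc (length-levels w)

sum-profile : ∀ (w : Vec Bool n) → sum (profile w) ≡ suc n + 2 * weight w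
sum-profile w = trans (sum-pairs (levels w)) (cong (_+ 2 * weight w) (length-levels w))

top-∷-≥ : ∀ b (w : Vec Bool n) → top w ≤ top (b ∷ w)
top-∷-≥ false w = ≤-refl
top-∷-≥ true  w = n≤1+n (top w)

top-∈-levels : ∀ (w : Vec Bool n) → top w ∈ levels w
top-∈-levels []      = here refl
top-∈-levels (b ∷ w) = here refl

levels-≤-top : ∀ (w : Vec Bool n) → All (_≤ top w) (levels w)
levels-≤-top []      = z≤n ∷ []
levels-≤-top (b ∷ w) = ≤-refl ∷ All.map (λ ℓ≤ → ≤-trans ℓ≤ (top-∷-≥ b w)) (levels-≤-top w)

pairs-≤ : ∀ {L} → All (_≤ k) L → All (_≤ suc k) (pairs L)
pairs-≤ []         = []
pairs-≤ (ℓ≤ ∷ L≤) = m≤n⇒m≤1+n ℓ≤ ∷ s≤s ℓ≤ ∷ pairs-≤ L≤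

∈-pairs : ∀ {ℓ L} → ℓ ∈ L → suc ℓ ∈ pairs L
∈-pairs (here refl) = there (here refl)
∈-pairs (there i)   = there (there (∈-pairs i))

top-mono : ∀ (w w′ : Vec Bool n) → profile w ↭ profile w′ → top w ≤ top w′
top-mono w w′ p = s≤s⁻¹ (All.lookup {P = _≤ suc (top w′)} (z≤n ∷ pairs-≤ (levels-≤-top w′))
  (↭ₚ.∈-resp-↭ p (there (∈-pairs (top-∈-levels w)))))

top-∷-injective : ∀ b b′ (w : Vec Bool n) → top (b ∷ w) ≡ top (b′ ∷ w) → b ≡ b′
top-∷-injective false false w eq = refl
top-∷-injective false true  w eq = contradiction (sym eq) 1+n≢n
top-∷-injective true  false w eq = contradiction eq 1+n≢n
top-∷-injective true  true  w eq = refl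

-- The largest height is `suc (top w)`, so the tops agree. Their pairs of heights cancel, the tails
-- agree by induction, and then equal tops force equal first bits.
profile-injective : ∀ (w w′ : Vec Bool n) → profile w ↭ profile w′ → w ≡ w′
profile-injective []      []        p = refl
profile-injective (b ∷ w) (b′ ∷ w′) p = cong₂ _∷_
  (top-∷-injective b b′ w (trans top≡ (cong (λ v → top (b′ ∷ v)) (sym w≡w′)))) w≡w′
  where
  top≡ : top (b ∷ w) ≡ top (b′ ∷ w′)
  top≡ = ≤-antisym (top-mono (b ∷ w) (b′ ∷ w′) p) (top-mono (b′ ∷ w′) (b ∷ w) (↭-sym p))
  w≡w′ : w ≡ w′
  w≡w′ = profile-injective w w′ (↭ₚ.drop-∷ (↭ₚ.drop-∷ (subst
    (λ t → top (b ∷ w) ∷ suc (top (b ∷ w)) ∷ profile w ↭ t ∷ suc t ∷ profile w′) (sym top≡)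
    (↭-trans (↭-sym (profile-∷ b w)) (↭-trans p (profile-∷ b′ w′))))))

-- The heights 0, ..., k - 1 of an initial ascent, built in the shape that `step` produces.
climb : ℕ → List ℕ
climb zero    = []
climb (suc k) = 0 ∷ map suc (climb k)

climb-∷ʳ : ∀ k s → climb (suc k) ++ s ≡ climb k ++ k ∷ s
climb-∷ʳ k s = trans (cong (_++ s) (snoc k)) (++-assoc (climb k) [ k ] s)
  where
  snoc : ∀ k → climb (suc k) ≡ climb k ++ [ k ]
  snoc zero    = refl
  snoc (suc k) = cong (0 ∷_) (trans (cong (map suc) (snoc k)) (map-++ suc (climb k) [ k ]))

-- A path starting with k + 1 up steps admits a new edge of level k or k + 1 crossing as many edges
-- as its level allows; the result again starts with enough up steps.
staircase : ∀ (w : Vec Bool n) → ∃ λ r →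
  Reach (suc n) (weight w) (climb (suc (top w)) ++ suc (top w) ∷ r)
  × climb (suc (top w)) ++ suc (top w) ∷ r ↭ profile w
staircase [] = [ 0 ] , step [] start , ↭-prep 0 (↭-swap 1 0 ↭-refl)
staircase {suc n} (false ∷ w) with r , R , p ← staircase w =
  ℓ ∷ suc ℓ ∷ r ,
  subst (λ c → Reach (suc (suc n)) c (climb (suc ℓ) ++ suc ℓ ∷ ℓ ∷ suc ℓ ∷ r)) (+-comm (weight w) ℓ)
    (step (climb ℓ) (subst (Reach _ _) (climb-∷ʳ ℓ (suc ℓ ∷ r)) R)) ,
  (begin
    climb (suc ℓ) ++ suc ℓ ∷ ℓ ∷ suc ℓ ∷ r       ↭⟨ ↭ₚ.shifts (climb (suc ℓ)) (suc ℓ ∷ ℓ ∷ []) ⟩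
    suc ℓ ∷ ℓ ∷ climb (suc ℓ) ++ suc ℓ ∷ r       ↭⟨ ↭-swap (suc ℓ) ℓ p ⟩
    ℓ ∷ suc ℓ ∷ profile w                        ↭⟨ profile-∷ false w ⟨
    profile (false ∷ w)                          ∎)
  where
  open ↭.PermutationReasoning
  ℓ = top w
staircase {suc n} (true ∷ w) with r , R , p ← staircase w =
  suc ℓ ∷ r ,
  subst (λ c → Reach (suc (suc n)) c (climb (suc (suc ℓ)) ++ suc (suc ℓ) ∷ suc ℓ ∷ r)) (+-comm (weight w) (suc ℓ))
    (step (climb (suc ℓ)) R) ,
  (begin
    climb (suc (suc ℓ)) ++ suc (suc ℓ) ∷ suc ℓ ∷ r          ≡⟨ climb-∷ʳ (suc ℓ) (suc (suc ℓ) ∷ suc ℓ ∷ r) ⟩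
    climb (suc ℓ) ++ suc ℓ ∷ suc (suc ℓ) ∷ suc ℓ ∷ r        ↭⟨ ↭ₚ.shifts (climb (suc ℓ)) (suc ℓ ∷ suc (suc ℓ) ∷ []) ⟩
    suc ℓ ∷ suc (suc ℓ) ∷ climb (suc ℓ) ++ suc ℓ ∷ r        ↭⟨ ↭-prep (suc ℓ) (↭-prep (suc (suc ℓ)) p) ⟩
    suc ℓ ∷ suc (suc ℓ) ∷ profile w                         ↭⟨ profile-∷ true w ⟨
    profile (true ∷ w)                                      ∎)
  where
  open ↭.PermutationReasoning
  ℓ = top w

-- To step up from a level above h, a path starting at h must first step up to that level.
Closed : ℕ → List ℕ → Set
Closed h L = ∀ ℓ → suc ℓ ∈ L → ℓ < h ⊎ ℓ ∈ L

-- The down steps not paired with an up step lead from `h` to 0; with the final 0 they contribute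
-- `climb (suc h)`. `L` lists the levels of the up steps.
path-levels : Path n h s → ∃ λ L → length L ≡ n × s ↭ climb (suc h) ++ pairs L × Closed h L
path-levels end = [] , refl , ↭-refl , λ _ ()
path-levels (up {h = h} {s = s} p) with L , len , s↭ , closed ← path-levels p =
  h ∷ L , cong suc len ,
  (begin
    h ∷ s                                         ↭⟨ ↭-prep h s↭ ⟩
    h ∷ climb (suc (suc h)) ++ pairs L            ≡⟨ cong (h ∷_) (climb-∷ʳ (suc h) (pairs L)) ⟩
    h ∷ climb (suc h) ++ suc h ∷ pairs L          ↭⟨ ↭ₚ.shift h (climb (suc h)) (suc h ∷ pairs L) ⟨
    climb (suc h) ++ h ∷ suc h ∷ pairs L          ∎) ,
  closed′
  where
  open ↭.PermutationReasoning
  closed′ : Closed h (h ∷ L)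
  closed′ ℓ (here eq) = inj₁ (≤-reflexive eq)
  closed′ ℓ (there i) with closed ℓ i
  ... | inj₂ j = inj₂ (there j)
  ... | inj₁ ℓ<1+h with m≤n⇒m<n∨m≡n (s≤s⁻¹ ℓ<1+h)
  ...   | inj₁ ℓ<h = inj₁ ℓ<h
  ...   | inj₂ ℓ≡h = inj₂ (here ℓ≡h)
path-levels (down {h = h} {s = s} p) with L , len , s↭ , closed ← path-levels p =
  L , len ,
  (begin
    suc h ∷ s                               ↭⟨ ↭-prep (suc h) s↭ ⟩
    suc h ∷ climb (suc h) ++ pairs L        ↭⟨ ↭ₚ.shift (suc h) (climb (suc h)) (pairs L) ⟨
    climb (suc h) ++ suc h ∷ pairs L        ≡⟨ climb-∷ʳ (suc h) (pairs L) ⟨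
    climb (suc (suc h)) ++ pairs L          ∎) ,
  λ ℓ i → Sum.map₁ m<n⇒m<1+n (closed ℓ i)
  where
  open ↭.PermutationReasoning

extract-max : ∀ x L → ∃₂ λ k M → x ∷ L ↭ k ∷ M × All (_≤ k) M
extract-max x [] = x , [] , ↭-refl , []
extract-max x (y ∷ L) with k , M , p , M≤k ← extract-max y L with ≤-total x k
... | inj₁ x≤k = k , x ∷ M , ↭-trans (↭-prep x p) (↭-swap x k ↭-refl) , x≤k ∷ M≤k
... | inj₂ k≤x = x , k ∷ M , ↭-prep x p , k≤x ∷ All.map (λ m≤k → ≤-trans m≤k k≤x) M≤k

closed-tail : ∀ {L M} → (∀ ℓ → suc ℓ ∈ L → ℓ ∈ L) → L ↭ k ∷ M → All (_≤ k) M → ∀ ℓ → suc ℓ ∈ M → ℓ ∈ M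
closed-tail closed p M≤k ℓ i with ↭ₚ.∈-resp-↭ p (closed ℓ (↭ₚ.∈-resp-↭ (↭-sym p) (there i)))
... | here refl = contradiction (All.lookup M≤k i) 1+n≰n
... | there j   = j

-- Remove a maximum and encode the rest. By closedness the maximum equals the top of the rest or
-- exceeds it by exactly one, and this decides the new bit.
closed⇒levels : ∀ n L → length L ≡ suc n → (∀ ℓ → suc ℓ ∈ L → ℓ ∈ L) → ∃ λ (w : Vec Bool n) → levels w ↭ L
closed⇒levels zero (zero ∷ [])  len closed = [] , ↭-refl
closed⇒levels zero (suc ℓ ∷ []) len closed with closed ℓ (here refl)
... | here ℓ≡1+ℓ = contradiction (sym ℓ≡1+ℓ) 1+n≢n
closed⇒levels (suc n) (x ∷ L) len closed with k , M , p , M≤k ← extract-max x L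
  with w , q ← closed⇒levels n M (suc-injective (trans (sym (↭ₚ.↭-length p)) len)) (closed-tail closed p M≤k)
  with m≤n⇒m<n∨m≡n (All.lookup M≤k (↭ₚ.∈-resp-↭ q (top-∈-levels w)))
... | inj₂ refl = false ∷ w , ↭-trans (↭-prep (top w) q) (↭-sym p)
... | inj₁ (s≤s {n = j} top≤j) with ↭ₚ.∈-resp-↭ p (closed j (↭ₚ.∈-resp-↭ (↭-sym p) (here refl)))
...   | here j≡1+j = contradiction (sym j≡1+j) 1+n≢n
...   | there i with refl ← ≤-antisym top≤j (All.lookup (levels-≤-top w) (↭ₚ.∈-resp-↭ (↭-sym q) i)) =
  true ∷ w , ↭-trans (↭-prep (suc (top w)) q) (↭-sym p)

reach⇒profile : Reach (suc n) c s → ∃ λ (w : Vec Bool n) → s ↭ profile w × c ≤ weight w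
reach⇒profile {n} {c} {s} R with L , len , s↭ , closed ← path-levels (reach⇒path R)
  with w , q ← closed⇒levels n L len (λ ℓ i → Sum.[ (λ ()) , id ] (closed ℓ i)) =
  -- The sum of the heights depends only on the profile, so `reach-bound` turns into a bound by
  -- `weight w`.
  w , s↭profile , *-cancelˡ-≤ 2 (+-cancelˡ-≤ (suc n) _ _ (begin
    suc n + 2 * c         ≤⟨ reach-bound R ⟩
    sum s                 ≡⟨ sum-↭ s↭profile ⟩
    sum (profile w)       ≡⟨ sum-profile w ⟩
    suc n + 2 * weight w  ∎))
  where
  open ≤-Reasoning
  s↭profile : s ↭ profile w
  s↭profile = ↭-trans s↭ (↭-prep 0 (pairs-↭ (↭-sym q)))

-- Matchings and their paths

applyUpTo-insert : ∀ (s : ℕ → ℕ) n a → applyUpTo s n ≡ a ++ h ∷ b →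
  s (length a) ≡ h × length a < n ×
  (∀ t → (∀ g → g ≤ length a → t g ≡ suc (s g)) → (∀ g → length a ≤ g → t (suc g) ≡ s g) →
    applyUpTo t (suc n) ≡ map suc a ++ suc h ∷ h ∷ b)
applyUpTo-insert s zero    []      ()
applyUpTo-insert s zero    (_ ∷ _) ()
applyUpTo-insert s (suc n) []      refl = refl , z<s , λ t t-≤ t-≥ →
  cong₂ _∷_ (t-≤ 0 z≤n) (cong₂ _∷_ (t-≥ 0 z≤n) (applyUpTo-cong (λ g → t-≥ (suc g) z≤n) n))
applyUpTo-insert s (suc n) (x ∷ a) eq
  with refl ← ∷-injectiveˡ eq
  with h≡ , a<n , insert ← applyUpTo-insert (s ∘ suc) n a (∷-injectiveʳ eq) =
  h≡ , s≤s a<n , λ t t-≤ t-≥ → cong₂ _∷_ (t-≤ 0 z≤n)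
    (insert (t ∘ suc) (λ g g≤a → t-≤ (suc g) (s≤s g≤a)) (λ g a≤g → t-≥ (suc g) (s≤s a≤g)))

applyUpTo-split : ∀ (s : ℕ → A) {n x} → x < n → ∃₂ λ a b → applyUpTo s n ≡ a ++ s x ∷ b × length a ≡ x
applyUpTo-split s {suc n} {zero}  x<n = [] , _ , refl , refl
applyUpTo-split s {suc n} {suc x} (s≤s x<n) with a , b , eq , len ← applyUpTo-split (s ∘ suc) x<n =
  s 0 ∷ a , b , cong (s 0 ∷_) eq , cong suc len

heights-child : ∀ {m} (f : Raw m) x a → heights {m} f ≡ a ++ h ∷ b → length a ≡ toℕ x →
  heights {suc m} (child {m} f x) ≡ 0 ∷ map suc a ++ suc h ∷ h ∷ b
heights-child {m = m} f x a eq len with _ , _ , insert ← applyUpTo-insert (height f) (suc (dbl m)) a eq =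
  cong₂ _∷_ (height-child-0 {m} f x) (insert (height (child {m} f x) ∘ suc)
    (λ g g≤a → height-child-≤ {m} f x g (≤-trans g≤a (≤-reflexive len)))
    (λ g a≤g → height-child-≥ {m} f x g (≤-trans (≤-reflexive (sym len)) a≤g)))

child-isMatching : ∀ {m} {f : Raw m} x → IsMatching {m} f → IsMatching {suc m} (child {m} f x)
child-isMatching {m} {f} x (f-inv , f-fix) = inv , fix
  where
  f′ = child {m} f x
  -- A vertex of the child is the new left end, its partner, or a relabelled old vertex.
  by-vertex : ∀ {P : Fin (dbl (suc m)) → Set} →
    P zero → P (suc x) → (∀ j → P (suc (punchIn x j))) → ∀ i → P i
  by-vertex p₀ pₓ p zero = p₀
  by-vertex {P} p₀ pₓ p (suc k) with x Fin.≟ k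
  ... | yes refl = pₓ
  ... | no x≢k   = subst (P ∘ suc) (Finₚ.punchIn-punchOut x≢k) (p (punchOut x≢k))
  inv : ∀ i → f′ (f′ i) ≡ i
  inv = by-vertex (child-new {m} f x) (cong f′ (child-new {m} f x)) λ j →
    trans (cong f′ (child-old {m} f x j)) (trans (child-old {m} f x (f j)) (cong (suc ∘ punchIn x) (f-inv j)))
  fix : ∀ i → f′ i ≢ i
  fix = by-vertex (λ ()) (λ eq → Finₚ.0≢1+n (trans (sym (child-new {m} f x)) eq)) λ j eq →
    f-fix j (Finₚ.punchIn-injective x _ _ (Finₚ.suc-injective (trans (sym (child-old {m} f x j)) eq)))

reach⇒matching : Reach n c s → Σ (Matching n) λ (f , _) → cr {n} f ≡ c × heights {n} f ≡ s
reach⇒matching start = ((λ ()) , (λ ()) , (λ ())) , refl , refl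
reach⇒matching (step {n} {c} {h} {b} a R)
  with (f , isM) , refl , heights≡ ← reach⇒matching R
  with h≡ , a<N , _ ← applyUpTo-insert (height f) (suc (dbl n)) a heights≡ =
  (child {n} f x , child-isMatching {n} x isM) ,
  trans (cr-child {n} f x) (cong (cr {n} f +_) (trans (cong (height f) (Finₚ.toℕ-fromℕ< a<N)) h≡)) ,
  heights-child {m = n} f x a heights≡ (sym (Finₚ.toℕ-fromℕ< a<N))
  where
  x = fromℕ< a<N

matching-is-child : ∀ {m} (f : Raw (suc m)) → IsMatching {suc m} f →
  ∃₂ λ (g : Raw m) x → IsMatching {m} g × child {m} g x ≗ f
matching-is-child {m} f (f-inv , f-fix) = result (f zero) refl
  where
  result : ∀ y → f zero ≡ y → ∃₂ λ (g : Raw m) x → IsMatching {m} g × child {m} g x ≗ f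
  result zero    f0≡ = contradiction f0≡ (f-fix zero)
  result (suc x) f0≡ = f₀ , x , (f₀-inv , f₀-fix) , child≗f
    where
    fx≡0 : f (suc x) ≡ zero
    fx≡0 = trans (cong f (sym f0≡)) (f-inv zero)
    -- The partner of an old vertex is neither `zero` nor `suc x`, since these are matched to each
    -- other; so it is old again.
    remove : ∀ j y → f (suc (punchIn x j)) ≡ y → ∃ λ i → suc (punchIn x i) ≡ y
    remove j zero    eq = contradiction
      (Finₚ.suc-injective (trans (sym (f-inv _)) (trans (cong f eq) f0≡))) (Finₚ.punchInᵢ≢i x j)
    remove j (suc l) eq = punchOut x≢l , cong suc (Finₚ.punchIn-punchOut x≢l)
      where
      x≢l : x ≢ l
      x≢l refl = Finₚ.0≢1+n (trans (sym fx≡0) (trans (cong f (sym eq)) (f-inv _)))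
    f₀ : Raw m
    f₀ j = proj₁ (remove j _ refl)
    old-f₀ : ∀ j → suc (punchIn x (f₀ j)) ≡ f (suc (punchIn x j))
    old-f₀ j = proj₂ (remove j _ refl)
    old-injective : ∀ {i j} → suc (punchIn x i) ≡ suc (punchIn x j) → i ≡ j
    old-injective = Finₚ.punchIn-injective x _ _ ∘ Finₚ.suc-injective
    f₀-inv : ∀ j → f₀ (f₀ j) ≡ j
    f₀-inv j = old-injective (trans (old-f₀ (f₀ j)) (trans (cong f (old-f₀ j)) (f-inv _)))
    f₀-fix : ∀ j → f₀ j ≢ j
    f₀-fix j eq = f-fix _ (trans (sym (old-f₀ j)) (cong (suc ∘ punchIn x) eq))
    child≗f : child {m} f₀ x ≗ f
    child≗f zero    = sym f0≡
    child≗f (suc k) with x Fin.≟ k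
    ... | yes refl = sym fx≡0
    ... | no x≢k   = trans (old-f₀ (punchOut x≢k)) (cong (f ∘ suc) (Finₚ.punchIn-punchOut x≢k))

matching⇒reach : ∀ m (f : Raw m) → IsMatching {m} f → Reach m (cr {m} f) (heights {m} f)
matching⇒reach zero    f isM = start
matching⇒reach (suc m) f isM
  with g , x , isM′ , g≗f ← matching-is-child {m} f isM
  with a , b , heights≡ , len ← applyUpTo-split (height g) (Finₚ.toℕ<n x) =
  -- The child of `g` agrees with `f` only pointwise, so crossings and heights are carried over by
  -- congruence.
  subst₂ (Reach (suc m))
    (trans (sym (cr-child {m} g x)) (cr-cong {suc m} g≗f))
    (trans (sym (heights-child {m = m} g x a heights≡ len)) (applyUpTo-cong (height-cong {suc m} g≗f) _))
    (step a (subst (Reach m _) heights≡ (matching⇒reach m g isM′)))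

-- Representatives of the classes

words : ∀ n → List (Vec Bool n)
words zero    = [ [] ]
words (suc n) = map (false ∷_) (words n) ++ map (true ∷_) (words n)

∈-words : ∀ (w : Vec Bool n) → w ∈ words n
∈-words []          = here refl
∈-words (false ∷ w) = ∈-++⁺ˡ (∈-map⁺ (false ∷_) (∈-words w))
∈-words (true ∷ w)  = ∈-++⁺ʳ _ (∈-map⁺ (true ∷_) (∈-words w))

words-distinct : ∀ n → AllPairs _≢_ (words n)
words-distinct zero    = [] ∷ []
words-distinct (suc n) = AllPairs.++⁺
  (AllPairs.map⁺ (AllPairs.map (λ { w≢ refl → w≢ refl }) (words-distinct n)))
  (AllPairs.map⁺ (AllPairs.map (λ { w≢ refl → w≢ refl }) (words-distinct n)))
  (All.map⁺ (All.universal (λ _ → All.map⁺ (All.universal (λ _ ()) (words n))) (words n)))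

-- Abstract because unfolding the constructed matchings is expensive.
abstract
  representative : ∀ (w : Vec Bool n) d → Σ (Matching (suc n)) λ (f , _) →
    cr {suc n} f ≡ weight w ∸ d × heights {suc n} f ↭ profile w
  representative w d with r , R , s↭ ← staircase w with M , cr≡ , heights≡ ← reach⇒matching (lower^ d R) =
    M , cr≡ , ↭-trans (↭-reflexive heights≡) s↭

rep : Vec Bool n → ℕ → Matching (suc n)
rep w d = proj₁ (representative w d)

rep-cr : ∀ (w : Vec Bool n) d → cr {suc n} (proj₁ (rep w d)) ≡ weight w ∸ d
rep-cr w d = proj₁ (proj₂ (representative w d))

rep-heights : ∀ (w : Vec Bool n) d → heights {suc n} (proj₁ (rep w d)) ↭ profile w
rep-heights w d = proj₂ (proj₂ (representative w d))

-- The parameter `d` is the deficit from the maximal crossing number; it runs from 0 to `weight w`.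
repsOf : Vec Bool n → List (Matching (suc n))
repsOf w = map (rep w) (upTo (suc (weight w)))

reps : ∀ n → List (Matching (suc n))
reps n = concatMap repsOf (words n)

_≁_ : Matching n → Matching n → Set
_≁_ {n} (f , _) (g , _) = ¬ (_∼cr_ {n} f g)

rep-profile : ∀ (w w′ : Vec Bool n) d d′ → w ≢ w′ → rep w d ≁ rep w′ d′
rep-profile {n} w w′ d d′ w≢w′ ∼ = w≢w′ (profile-injective w w′
  (↭-trans (↭-sym (rep-heights w d)) (↭-trans heights↭ (rep-heights w′ d′))))
  where
  heights↭ = proj₂ (∼cr⇒≈cr {suc n} {proj₁ (rep w d)} {proj₁ (rep w′ d′)} ∼)

rep-deficit : ∀ (w : Vec Bool n) {d d′} → d < d′ → d′ < suc (weight w) → rep w d ≁ rep w d′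
rep-deficit {n} w {d} {d′} d<d′ d′≤ ∼ = <⇒≢ d<d′ (∸-cancelˡ-≡
  (≤-trans (<⇒≤ d<d′) (s≤s⁻¹ d′≤)) (s≤s⁻¹ d′≤)
  (trans (sym (rep-cr w d)) (trans cr≡ (rep-cr w d′))))
  where
  cr≡ = proj₁ (∼cr⇒≈cr {suc n} {proj₁ (rep w d)} {proj₁ (rep w d′)} ∼)

-- Within a block the crossing numbers differ; between blocks the height multisets do.
reps-inequivalent : ∀ n → AllPairs _≁_ (reps n)
reps-inequivalent n = AllPairs.concat⁺
  (All.map⁺ (All.universal
    (λ w → AllPairs.map⁺ (AllPairs.applyUpTo⁺₁ id (suc (weight w)) (rep-deficit w))) (words n)))
  (AllPairs.map⁺ (AllPairs.map
    (λ {w} {w′} w≢w′ → All.map⁺ (All.universal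
      (λ d → All.map⁺ (All.universal (λ d′ → rep-profile w w′ d d′ w≢w′) _)) _))
    (words-distinct n)))

rep-∈-reps : ∀ (w : Vec Bool n) {d} → d ≤ weight w → rep w d ∈ reps n
rep-∈-reps w d≤ = Any.concatMap⁺ repsOf (lose (∈-words w) (∈-map⁺ (rep w) (∈-upTo⁺ (s≤s d≤))))

reps-cover : ∀ n (M : Matching (suc n)) → Any (λ R → _∼cr_ {suc n} (proj₁ M) (proj₁ R)) (reps n)
reps-cover n (f , isM) = cover (reach⇒profile (matching⇒reach (suc n) f isM))
  where
  cover : (∃ λ (w : Vec Bool n) → heights {suc n} f ↭ profile w × cr {suc n} f ≤ weight w) →
          Any (λ R → _∼cr_ {suc n} f (proj₁ R)) (reps n)
  cover (w , heights↭ , c≤) = lose (rep-∈-reps w (m∸n≤m (weight w) (cr {suc n} f)))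
    (≈cr⇒∼cr {suc n} {f} {proj₁ (rep w (weight w ∸ cr {suc n} f))}
      (trans (sym (m∸[m∸n]≡n c≤)) (sym (rep-cr w (weight w ∸ cr {suc n} f))) ,
       ↭-trans heights↭ (↭-sym (rep-heights w (weight w ∸ cr {suc n} f)))))

-- Counting

length-concatMap : ∀ (f : A → List B) xs → length (concatMap f xs) ≡ sum (map (length ∘ f) xs)
length-concatMap f []       = refl
length-concatMap f (x ∷ xs) = trans (length-++ (f x)) (cong (length (f x) +_) (length-concatMap f xs))

Σ-words : ∀ n → (Vec Bool n → ℕ) → ℕ
Σ-words n φ = sum (map φ (words n))

sum-map-+ : ∀ (φ ψ : A → ℕ) xs → sum (map (λ x → φ x + ψ x) xs) ≡ sum (map φ xs) + sum (map ψ xs)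
sum-map-+ φ ψ []       = refl
sum-map-+ φ ψ (x ∷ xs) = trans (cong (φ x + ψ x +_) (sum-map-+ φ ψ xs)) (interchange (φ x) (ψ x) _ _)

Σ-words-suc : ∀ n φ → Σ-words (suc n) φ ≡ Σ-words n (φ ∘ (false ∷_)) + Σ-words n (φ ∘ (true ∷_))
Σ-words-suc n φ = begin
  sum (map φ (map (false ∷_) (words n) ++ map (true ∷_) (words n)))
    ≡⟨ cong sum (map-++ φ (map (false ∷_) (words n)) _) ⟩
  sum (map φ (map (false ∷_) (words n)) ++ map φ (map (true ∷_) (words n)))
    ≡⟨ sum-++ (map φ (map (false ∷_) (words n))) _ ⟩
  sum (map φ (map (false ∷_) (words n))) + sum (map φ (map (true ∷_) (words n)))
    ≡⟨ cong₂ (λ xs ys → sum xs + sum ys) (map-∘ (words n)) (map-∘ (words n)) ⟨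
  Σ-words n (φ ∘ (false ∷_)) + Σ-words n (φ ∘ (true ∷_)) ∎
  where open ≡-Reasoning

Σ-words-1 : ∀ n → Σ-words n (λ _ → 1) ≡ 2 ^ n
Σ-words-1 zero    = refl
Σ-words-1 (suc n) = trans (Σ-words-suc n _) (cong₂ _+_ (Σ-words-1 n) (trans (Σ-words-1 n) (sym (+-identityʳ _))))

-- `top w` is the number of true bits, and each bit is true in half of the words.
Σ-words-top : ∀ n → 2 * Σ-words n top ≡ n * 2 ^ n
Σ-words-top zero    = refl
Σ-words-top (suc n) = begin
  2 * Σ-words (suc n) top                             ≡⟨ cong (2 *_) (Σ-words-suc n top) ⟩
  2 * (Σ-words n top + Σ-words n (λ w → 1 + top w))   ≡⟨ cong (λ x → 2 * (Σ-words n top + x)) (sum-map-+ (λ _ → 1) top (words n)) ⟩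
  2 * (Σ-words n top + (Σ-words n (λ _ → 1) + Σ-words n top))
                                                      ≡⟨ cong (λ x → 2 * (Σ-words n top + (x + Σ-words n top))) (Σ-words-1 n) ⟩
  2 * (Σ-words n top + (2 ^ n + Σ-words n top))       ≡⟨ rearrange (Σ-words n top) (2 ^ n) ⟩
  2 * (2 * Σ-words n top + 2 ^ n)                     ≡⟨ cong (λ x → 2 * (x + 2 ^ n)) (Σ-words-top n) ⟩
  2 * (n * 2 ^ n + 2 ^ n)                             ≡⟨ rearrange′ n (2 ^ n) ⟩
  suc n * 2 ^ suc n                                   ∎
  where
  open ≡-Reasoning
  rearrange : ∀ x y → 2 * (x + (y + x)) ≡ 2 * (2 * x + y)
  rearrange = solve-∀
  rearrange′ : ∀ n y → 2 * (n * y + y) ≡ suc n * (2 * y)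
  rearrange′ = solve-∀

-- A new first bit adds the new top to the weight, so the sum of the tops enters the recursion.
Σ-words-weight : ∀ n →
  Σ-words (suc n) (suc ∘ weight) ≡ 2 * Σ-words n (suc ∘ weight) + suc n * 2 ^ n
Σ-words-weight n = begin
  Σ-words (suc n) (suc ∘ weight)
    ≡⟨ Σ-words-suc n (suc ∘ weight) ⟩
  Σ-words n (λ w → 1 + (top w + weight w)) + Σ-words n (λ w → 1 + (suc (top w) + weight w))
    ≡⟨ cong₂ (λ xs ys → sum xs + sum ys)
         (map-cong (λ w → sym (+-suc (top w) (weight w))) (words n))
         (map-cong (λ w → cong suc (sym (+-suc (top w) (weight w)))) (words n)) ⟩
  Σ-words n (λ w → top w + suc (weight w)) + Σ-words n (λ w → 1 + (top w + suc (weight w)))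
    ≡⟨ cong (Σ-words n (λ w → top w + suc (weight w)) +_) (sum-map-+ (λ _ → 1) (λ w → top w + suc (weight w)) (words n)) ⟩
  Σ-words n (λ w → top w + suc (weight w)) + (Σ-words n (λ _ → 1) + Σ-words n (λ w → top w + suc (weight w)))
    ≡⟨ cong₂ (λ x y → x + (y + x)) (sum-map-+ top (suc ∘ weight) (words n)) (Σ-words-1 n) ⟩
  (K + W) + (2 ^ n + (K + W))
    ≡⟨ rearrange K W (2 ^ n) ⟩
  2 * W + (2 * K + 2 ^ n)
    ≡⟨ cong (λ x → 2 * W + (x + 2 ^ n)) (Σ-words-top n) ⟩
  2 * W + (n * 2 ^ n + 2 ^ n)
    ≡⟨ cong (2 * W +_) (+-comm (n * 2 ^ n) (2 ^ n)) ⟩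
  2 * W + suc n * 2 ^ n ∎
  where
  open ≡-Reasoning
  K = Σ-words n top
  W = Σ-words n (suc ∘ weight)
  rearrange : ∀ x y z → (x + y) + (z + (x + y)) ≡ 2 * y + (2 * x + z)
  rearrange = solve-∀

-- The factor 4 clears the negative exponent that `2^(n-2)` has at n = 1; the induction step is
-- Pascal's rule.
4*Σ-words-weight : ∀ n → 4 * Σ-words n (suc ∘ weight) ≡ 2 ^ suc n * ((suc n C 2) + 2)
4*Σ-words-weight zero    = refl
4*Σ-words-weight (suc n) = begin
  4 * Σ-words (suc n) (suc ∘ weight)                           ≡⟨ cong (4 *_) (Σ-words-weight n) ⟩
  4 * (2 * Σ-words n (suc ∘ weight) + suc n * 2 ^ n)           ≡⟨ rearrange (Σ-words n (suc ∘ weight)) (suc n) (2 ^ n) ⟩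
  2 * (4 * Σ-words n (suc ∘ weight)) + 4 * (suc n * 2 ^ n)     ≡⟨ cong (λ x → 2 * x + 4 * (suc n * 2 ^ n)) (4*Σ-words-weight n) ⟩
  2 * (2 ^ suc n * ((suc n C 2) + 2)) + 4 * (suc n * 2 ^ n)    ≡⟨ rearrange′ (suc n) (2 ^ n) (suc n C 2) ⟩
  2 ^ suc (suc n) * ((suc n + (suc n C 2)) + 2)                ≡⟨ cong (λ x → 2 ^ suc (suc n) * ((x + (suc n C 2)) + 2)) (nC1≡n (suc n)) ⟨
  2 ^ suc (suc n) * (((suc n C 1) + (suc n C 2)) + 2)          ≡⟨ cong (λ x → 2 ^ suc (suc n) * (x + 2)) (nCk+nC[k+1]≡[n+1]C[k+1] (suc n) 1) ⟩
  2 ^ suc (suc n) * ((suc (suc n) C 2) + 2)                    ∎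
  where
  open ≡-Reasoning
  rearrange : ∀ x m p → 4 * (2 * x + m * p) ≡ 2 * (4 * x) + 4 * (m * p)
  rearrange = solve-∀
  rearrange′ : ∀ m p y → 2 * ((2 * p) * (y + 2)) + 4 * (m * p) ≡ (2 * (2 * p)) * ((m + y) + 2)
  rearrange′ = solve-∀

length-reps : ∀ n → length (reps n) ≡ Σ-words n (suc ∘ weight)
length-reps n = trans (length-concatMap repsOf (words n)) (cong sum (map-cong
  (λ w → trans (length-map (rep w) (upTo (suc (weight w)))) (length-upTo (suc (weight w)))) (words n)))

theorem3p3 : ∀ (n : ℕ) → 1 ≤ n →
    Σ ℕ (λ k → NumClasses n k × (4 * k ≡ 2 ^ n * ((n C 2) + 2)))
theorem3p3 (suc n) _ =
  length (reps n) , (reps n , refl , reps-inequivalent n , reps-cover n) ,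
  trans (cong (4 *_) (length-reps n)) (4*Σ-words-weight n)
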